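{- Let $\mathcal{H}=(V,E)$ be a linear hypergraph without loop, with $n$ vertices, such that $\Delta(\mathcal{H})\le \sqrt{n}+1$. Then $\mathrm{q}(\mathcal{H})\le n$.
   Context: A hypergraph $\mathcal{H}=(V,E)$ has a finite vertex set $V$ and a finite set $E$ of nonempty subsets of $V$ (hyperedges); a loop is a hyperedge with one element; linear means distinct hyperedges share at most one vertex. $\Delta(\mathcal{H})$ is the maximum number of hyperedges containing a vertex. The chromatic index $\mathrm{q}(\mathcal{H})$ is the least number of colors in a coloring of hyperedges where distinct intersecting hyperedges get different colors. -}

module Defs where

open import Data.Bool.Properties using () renaming (_≟_ to _≟ᵇ_)
open import Data.Fin using (Fin; finToFun; funToFin)
open import Data.Fin.Properties using (any?; all?; finToFun-funToFin) renaming (_≟_ to _≟ᶠ_)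
open import Data.Fin.Subset using (Subset; _∩_; ∣_∣; Nonempty)
open import Data.Fin.Subset.Properties using (_∈?_; nonempty?)
open import Data.List using (List; length; lookup; filter; map; allFin)
open import Data.List.Extrema.Nat using (max)
open import Data.List.Membership.Propositional using (_∈_)
open import Data.List.Relation.Unary.All using (All)
open import Data.List.Relation.Unary.Unique.Propositional using (Unique)
open import Data.Nat using (ℕ; zero; suc; _+_; _∸_; _^_; _≤_; z≤n)
open import Data.Nat.Properties using (+-identityʳ; +-suc; ≤∧≢⇒<)
open import Data.Product using (∃; _×_; _,_; proj₁; proj₂)
open import Data.Vec.Properties using (≡-dec)
open import Function using (id)
open import Relation.Binary.PropositionalEquality using (_≡_; _≢_; sym; trans; cong; subst)
open import Relation.Nullary using (Dec; yes; no; ¬?)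
open import Relation.Nullary.Decidable using (_→-dec_; map′)
open import Relation.Unary using (Pred; Decidable)

-- The vertex set is Fin n; the finite set of hyperedges is a list without
-- repetitions.
record Hypergraph (n : ℕ) : Set where
  field
    edges    : List (Subset n)
    unique   : Unique edges
    nonempty : All Nonempty edges

open Hypergraph public

Loopless : ∀ {n} → Hypergraph n → Set
Loopless H = ∀ {e} → e ∈ edges H → ∣ e ∣ ≢ 1

Linear : ∀ {n} → Hypergraph n → Set
Linear H = ∀ {e f} → e ∈ edges H → f ∈ edges H → e ≢ f → ∣ e ∩ f ∣ ≤ 1

degree : ∀ {n} → Hypergraph n → Fin n → ℕ
degree H v = length (filter (v ∈?_) (edges H))

-- The maximum over the empty vertex set is 0.
Δ : ∀ {n} → Hypergraph n → ℕ
Δ {n} H = max 0 (map (degree H) (allFin n))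

-- For natural numbers m and n, the real inequality m ≤ √n + 1 says that m - 1
-- is negative or has square at most n.  Truncated subtraction covers m = 0,
-- where both sides hold.
infix 4 _≤√_+1
_≤√_+1 : ℕ → ℕ → Set
m ≤√ n +1 = (m ∸ 1) ^ 2 ≤ n

-- Colours are assigned to positions in the list of hyperedges, so that a
-- hypergraph without hyperedges has a colouring with 0 colours.
IsColouring : ∀ {n} (H : Hypergraph n) {k : ℕ} → (Fin (length (edges H)) → Fin k) → Set
IsColouring H c =
  ∀ i j →
  lookup (edges H) i ≢ lookup (edges H) j →
  Nonempty (lookup (edges H) i ∩ lookup (edges H) j) →
  c i ≢ c j

Colourable : ∀ {n} → Hypergraph n → ℕ → Set
Colourable H k = ∃ λ (c : Fin (length (edges H)) → Fin k) → IsColouring H c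

isColouring? : ∀ {n} (H : Hypergraph n) {k : ℕ} (c : Fin (length (edges H)) → Fin k) →
               Dec (IsColouring H c)
isColouring? H c = all? λ i → all? λ j →
  ¬? (≡-dec _≟ᵇ_ (lookup (edges H) i) (lookup (edges H) j)) →-dec
  (nonempty? (lookup (edges H) i ∩ lookup (edges H) j) →-dec
  ¬? (c i ≟ᶠ c j))

colourable? : ∀ {n} (H : Hypergraph n) → Decidable (Colourable H)
colourable? H k = map′ to from (any? λ x → isColouring? H (finToFun {k} {length (edges H)} x))
  where
  to : (∃ λ x → IsColouring H (finToFun {k} {length (edges H)} x)) → Colourable H k
  to (x , p) = finToFun x , p

  from : Colourable H k → ∃ λ x → IsColouring H (finToFun {k} {length (edges H)} x)
  from (c , p) = funToFin c , λ i j i≢j meet eq →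
    p i j i≢j meet
      (trans (sym (finToFun-funToFin c i)) (trans eq (finToFun-funToFin c j)))

colourable-length : ∀ {n} (H : Hypergraph n) → Colourable H (length (edges H))
colourable-length H = id , λ i j i≢j _ i≡j → i≢j (cong (lookup (edges H)) i≡j)

IsLeast : ∀ {p} → Pred ℕ p → Pred ℕ p
IsLeast P k = P k × (∀ j → P j → k ≤ j)

least : ∀ {p} {P : Pred ℕ p} → Decidable P → ∀ {b} → P b → ∃ (IsLeast P)
least {P = P} P? {b} Pb = search b 0 (subst P (sym (+-identityʳ b)) Pb) (λ _ _ → z≤n)
  where
  search : ∀ d k → P (d + k) → (∀ j → P j → k ≤ j) → ∃ (IsLeast P)
  search zero    k Pk   k≤ = k , Pk , k≤
  search (suc d) k Pd+k k≤ with P? k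
  ... | yes Pk = k , Pk , k≤
  ... | no ¬Pk = search d (suc k) (subst P (sym (+-suc d k)) Pd+k)
    λ j Pj → ≤∧≢⇒< (k≤ j Pj) λ k≡j → ¬Pk (subst P (sym k≡j) Pj)

chromaticIndex : ∀ {n} → Hypergraph n → ℕ
chromaticIndex H = proj₁ (least (colourable? H) (colourable-length H))

chromaticIndex-isLeast : ∀ {n} (H : Hypergraph n) → IsLeast (Colourable H) (chromaticIndex H)
chromaticIndex-isLeast H = proj₂ (least (colourable? H) (colourable-length H))

{-# OPTIONS --safe #-}
module Submission where

-- Colour the hyperedges greedily by decreasing size with n colours.  Linearity
-- shows that a hyperedge of size k meets at most k (n − k) / (k − 1) others of
-- size ≥ k, which is less than n if k² > n; if k² < n, the degree bound leaves
-- at most k √n < n of them.  Only k² = n can go wrong, and then a hyperedge e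
-- with n conflicts forces equality throughout: the hyperedges of size ≥ k form
-- a part of an affine plane, those missing e are pairwise disjoint, and two of
-- those meeting e are disjoint from each other.  One colour for e and
-- the hyperedges missing it, one for those two, and one for each of the rest
-- make at most n colours.

open import Defs
import Algebra.Properties.Semiring.Sum
open import Data.Bool using (true; false; if_then_else_)
open import Data.Empty using (⊥)
open import Data.Fin using (Fin; zero; suc)
open import Data.Fin.Properties using (any?; all?; _≟_; ¬∀⟶∃¬; suc-injective)
open import Data.Fin.Subset using (Subset; inside; outside; _∈_; ∣_∣)
open import Data.Fin.Subset.Properties
  using (_∈?_; x∈p∩q⁺; x∈p∩q⁻; x∈p∧x≢y⇒x∈p-y; x∈p⇒∣p-x∣<∣p∣)
open import Data.List using (List; []; _∷_; length; lookup; filter; map; allFin)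
import Data.List.Membership.Propositional as List
open import Data.List.Membership.Propositional.Properties using (∈-lookup; ∈-allFin; ∈-map⁺)
open import Data.List.Extrema.Nat using (xs≤max)
import Data.List.Relation.Unary.All as All
open import Data.List.Relation.Unary.Any using (here; there)
open import Data.List.Relation.Unary.AllPairs using (_∷_)
open import Data.List.Relation.Unary.Unique.Propositional using (Unique)
open import Data.Nat using (ℕ; zero; suc; _+_; _*_; _∸_; _≤_; _<_; z≤n; s≤s; s≤s⁻¹; z<s; _≤?_; >-nonZero)
open import Data.Nat.Properties hiding (suc-injective) renaming (_≟_ to _≟ⁿ_)
open import Data.Product using (∃; _×_; _,_; proj₁; proj₂)
open import Data.Sum using (_⊎_; inj₁; inj₂)
open import Data.Vec using ([]; _∷_; here)
open import Data.Vec.Functional using (updateAt)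
open import Data.Vec.Functional.Properties using (updateAt-updates; updateAt-minimal)
open import Data.Unit using (tt)
open import Function using (const; _∘_)
open import Relation.Binary using (tri<; tri≈; tri>)
open import Relation.Binary.PropositionalEquality
  using (_≡_; _≢_; refl; sym; trans; cong; subst)
open import Relation.Nullary using (Dec; yes; no; ¬_; ¬?; does; _because_; contradiction)
open import Relation.Nullary.Decidable using (_×-dec_; _⊎-dec_; decidable-stable)

open Algebra.Properties.Semiring.Sum +-*-semiring
  using (sum; sum-cong-≗; ∑-distrib-+; ∑-comm; *-distribˡ-sum; *-distribʳ-sum)

-- Sums and indicators

sum-mono : ∀ {n} {f g : Fin n → ℕ} → (∀ i → f i ≤ g i) → sum f ≤ sum g
sum-mono {zero}  f≤g = z≤n
sum-mono {suc n} f≤g = +-mono-≤ (f≤g zero) (sum-mono (f≤g ∘ suc))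

-- If the totals agree, no term can fall short. The equality case uses this to read exact local
-- counts off chains of inequalities between sums.
sum-mono-rigid : ∀ {n} {f g : Fin n → ℕ} → (∀ i → f i ≤ g i) → sum g ≤ sum f → ∀ i → f i ≡ g i
sum-mono-rigid {suc n} {f} {g} f≤g Σg≤Σf = λ where
    zero    → ≤-antisym (f≤g zero)
                (+-cancelʳ-≤ (sum (g ∘ suc)) _ _
                  (≤-trans Σg≤Σf (+-monoʳ-≤ (f zero) (sum-mono (f≤g ∘ suc)))))
    (suc i) → sum-mono-rigid (f≤g ∘ suc)
                (+-cancelˡ-≤ (g zero) _ _
                  (≤-trans Σg≤Σf (+-monoˡ-≤ (sum (f ∘ suc)) (f≤g zero)))) i

term≤sum : ∀ {n} (f : Fin n → ℕ) i → f i ≤ sum f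
term≤sum f zero    = m≤m+n _ _
term≤sum f (suc i) = ≤-trans (term≤sum (f ∘ suc) i) (m≤n+m _ _)

⟦_⟧ : {P : Set} → Dec P → ℕ
⟦ d ⟧ = if does d then 1 else 0

⟦⟧-true : {P : Set} (d : Dec P) → P → ⟦ d ⟧ ≡ 1
⟦⟧-true (yes _) p = refl
⟦⟧-true (no ¬p) p = contradiction p ¬p

⟦⟧-≤ : {P : Set} (d : Dec P) {k : ℕ} → (P → 1 ≤ k) → ⟦ d ⟧ ≤ k
⟦⟧-≤ (yes p) 1≤k = 1≤k p
⟦⟧-≤ (no _)  1≤k = z≤n

⟦⟧-mono : {P Q : Set} (d : Dec P) (e : Dec Q) → (P → Q) → ⟦ d ⟧ ≤ ⟦ e ⟧
⟦⟧-mono d e P⇒Q = ⟦⟧-≤ d λ p → ≤-reflexive (sym (⟦⟧-true e (P⇒Q p)))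

⟦⟧-× : {P Q : Set} (d : Dec P) (e : Dec Q) → ⟦ d ×-dec e ⟧ ≡ ⟦ d ⟧ * ⟦ e ⟧
⟦⟧-× (false because _) e                   = refl
⟦⟧-× (true because _)  (false because _)   = refl
⟦⟧-× (true because _)  (true because _)    = refl

# : ∀ {n} {P : Fin n → Set} → (∀ i → Dec (P i)) → ℕ
# P? = sum λ i → ⟦ P? i ⟧

module _ {n : ℕ} {P : Fin n → Set} (P? : ∀ i → Dec (P i)) where

  #-mono : {Q : Fin n → Set} (Q? : ∀ i → Dec (Q i)) → (∀ i → P i → Q i) → # P? ≤ # Q?
  #-mono Q? P⇒Q = sum-mono λ i → ⟦⟧-mono (P? i) (Q? i) (P⇒Q i)

  ⟦⟧≤# : {Q : Set} (d : Dec Q) → (Q → ∃ P) → ⟦ d ⟧ ≤ # P?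
  ⟦⟧≤# d Q⇒∃P = ⟦⟧-≤ d λ q → let i , p = Q⇒∃P q in
    ≤-trans (≤-reflexive (sym (⟦⟧-true (P? i) p))) (term≤sum (λ i → ⟦ P? i ⟧) i)

#-∃ : ∀ {n} {P : Fin n → Set} (P? : ∀ i → Dec (P i)) → 0 < # P? → ∃ P
#-∃ {suc n} P? 0<# with P? zero
... | yes p = zero , p
... | no  _ = let i , p = #-∃ (P? ∘ suc) 0<# in suc i , p

#-empty : ∀ {n} {P : Fin n → Set} (P? : ∀ i → Dec (P i)) → (∀ i → ¬ P i) → # P? ≡ 0
#-empty P? ¬P with # P? in eq
... | zero  = refl
... | suc _ = let i , p = #-∃ P? (subst (0 <_) (sym eq) z<s) in contradiction p (¬P i)

#-subsingleton : ∀ {n} {P : Fin n → Set} (P? : ∀ i → Dec (P i)) →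
                 (∀ i j → P i → P j → i ≡ j) → # P? ≤ 1
#-subsingleton {zero}  P? unique = z≤n
#-subsingleton {suc n} P? unique with P? zero
... | no  _ = #-subsingleton (P? ∘ suc) λ i j p q → suc-injective (unique (suc i) (suc j) p q)
... | yes p = s≤s (≤-reflexive (#-empty (P? ∘ suc) λ i q → contradiction (unique zero (suc i) p q) λ ()))

#≤⟦⟧ : ∀ {n} {P : Fin n → Set} (P? : ∀ i → Dec (P i)) {Q : Set} (d : Dec Q) →
       (∀ i → P i → Q) → (∀ i j → P i → P j → i ≡ j) → # P? ≤ ⟦ d ⟧
#≤⟦⟧ P? (yes _) P⇒Q unique = #-subsingleton P? unique
#≤⟦⟧ P? (no ¬q) P⇒Q unique = ≤-reflexive (#-empty P? λ i p → ¬q (P⇒Q i p))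

#-remove : ∀ {n} {P : Fin n → Set} (P? : ∀ i → Dec (P i)) i → P i →
           # P? ≡ suc (# λ j → P? j ×-dec ¬? (i ≟ j))
#-remove P? i p = ≤-antisym
    (≤-trans (sum-mono below)
      (≤-trans (≤-reflexive (∑-distrib-+ (λ j → ⟦ i ≟ j ⟧) _))
        (+-monoˡ-≤ _ (#-subsingleton (i ≟_) λ _ _ p q → trans (sym p) q))))
    (≤-trans (+-monoˡ-≤ _ (⟦⟧≤# (i ≟_) (yes tt) λ _ → i , refl))
      (≤-trans (≤-reflexive (sym (∑-distrib-+ (λ j → ⟦ i ≟ j ⟧) _))) (sum-mono above)))
  where
  below : ∀ j → ⟦ P? j ⟧ ≤ ⟦ i ≟ j ⟧ + ⟦ P? j ×-dec ¬? (i ≟ j) ⟧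
  below j with i ≟ j | P? j
  ... | yes _ | yes _ = s≤s z≤n
  ... | yes _ | no  _ = z≤n
  ... | no  _ | yes _ = ≤-refl
  ... | no  _ | no  _ = ≤-refl
  above : ∀ j → ⟦ i ≟ j ⟧ + ⟦ P? j ×-dec ¬? (i ≟ j) ⟧ ≤ ⟦ P? j ⟧
  above j with i ≟ j | P? j
  ... | yes refl | yes _ = ≤-refl
  ... | yes refl | no ¬p = contradiction p ¬p
  ... | no  _    | yes _ = ≤-refl
  ... | no  _    | no  _ = ≤-refl

#-¬ : ∀ {n} {P : Fin n → Set} (P? : ∀ i → Dec (P i)) → (# λ i → ¬? (P? i)) + # P? ≡ n
#-¬ {zero}  P? = refl
#-¬ {suc n} P? with P? zero
... | yes _ = trans (+-suc _ _) (cong suc (#-¬ (P? ∘ suc)))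
... | no  _ = cong suc (#-¬ (P? ∘ suc))

sum-⟦⟧*const : ∀ {n} {P : Fin n → Set} (P? : ∀ i → Dec (P i)) k →
               sum (λ i → ⟦ P? i ⟧ * k) ≡ # P? * k
sum-⟦⟧*const P? k = sym (*-distribʳ-sum k λ i → ⟦ P? i ⟧)

-- Pairs are counted by rows and by columns. On the left the indicator stays a factor, so that the
-- inner count need be bounded only where `P` holds, by `⟦⟧*-mono`.
double-count : ∀ {m n} {P : Fin m → Set} {Q : Fin m → Fin n → Set}
               (P? : ∀ i → Dec (P i)) (Q? : ∀ i j → Dec (Q i j)) →
               sum (λ i → ⟦ P? i ⟧ * # (Q? i)) ≡ sum λ j → # λ i → P? i ×-dec Q? i j
double-count P? Q? = trans
  (sum-cong-≗ λ i → trans (*-distribˡ-sum ⟦ P? i ⟧ λ j → ⟦ Q? i j ⟧)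
                          (sum-cong-≗ λ j → sym (⟦⟧-× (P? i) (Q? i j))))
  (∑-comm λ i j → ⟦ P? i ×-dec Q? i j ⟧)

⟦⟧*-mono : {P : Set} (d : Dec P) {j k : ℕ} → (P → j ≤ k) → ⟦ d ⟧ * j ≤ ⟦ d ⟧ * k
⟦⟧*-mono (yes p) j≤k = +-monoˡ-≤ 0 (j≤k p)
⟦⟧*-mono (no _)  j≤k = z≤n

⟦⟧*-cancel : {P : Set} (d : Dec P) {j k : ℕ} → ⟦ d ⟧ * j ≡ ⟦ d ⟧ * k → P → j ≡ k
⟦⟧*-cancel (yes _) eq p = +-cancelʳ-≡ 0 _ _ eq
⟦⟧*-cancel (no ¬p) eq p = contradiction p ¬p

-- Greedy colouring

-- Pigeonhole by double counting: if every value were taken, each of the `n` values would come from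
-- some `j` in `B`, while each `j` accounts for only one value.
free-value : ∀ {m n} {B : Fin m → Set} (B? : ∀ j → Dec (B j)) (c : Fin m → Fin n) →
             # B? < n → ∃ λ a → ∀ j → B j → c j ≢ a
free-value {m} {n} {B} B? c #B<n with all? (λ a → any? (λ j → B? j ×-dec (c j ≟ a)))
... | no ¬all =
  let a , ¬hit = ¬∀⟶∃¬ n _ (λ a → any? λ j → B? j ×-dec (c j ≟ a)) ¬all
  in a , λ j b eq → ¬hit (j , b , eq)
... | yes hit = contradiction #B<n (≤⇒≯ (begin
    n                                                ≡⟨ sym (#-⊤ n) ⟩
    (# λ (_ : Fin n) → yes tt)                       ≤⟨ sum-mono (λ a → ⟦⟧≤# (λ j → B? j ×-dec (c j ≟ a)) (yes tt) λ _ → hit a) ⟩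
    (sum λ a → # λ j → B? j ×-dec (c j ≟ a))         ≡⟨ sym (double-count B? λ j a → c j ≟ a) ⟩
    (sum λ j → ⟦ B? j ⟧ * # (c j ≟_))                ≤⟨ sum-mono (λ j → *-monoʳ-≤ ⟦ B? j ⟧ (#-subsingleton (c j ≟_) λ _ _ p q → trans (sym p) q)) ⟩
    (sum λ j → ⟦ B? j ⟧ * 1)                         ≡⟨ sum-⟦⟧*const B? 1 ⟩
    # B? * 1                                         ≡⟨ *-identityʳ _ ⟩
    # B?                                             ∎))
  where
  open ≤-Reasoning
  #-⊤ : ∀ k → (# λ (_ : Fin k) → yes tt) ≡ k
  #-⊤ zero    = refl
  #-⊤ (suc k) = cong suc (#-⊤ k)

Proper : ∀ {m n} (R : Fin m → Fin m → Set) (A : Fin m → Set) → (Fin m → Fin n) → Set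
Proper R A c = ∀ i j → A i → A j → R i j → c i ≢ c j

-- Members of `A` keep their colours and the rest of `S` is recoloured one by one. The hypothesis
-- bounds the conflicts within all of `S`, treated or not, so any order works.
greedy : ∀ {m n} {R : Fin m → Fin m → Set} {A S : Fin m → Set} →
         (∀ i → ¬ R i i) → (∀ i j → R i j → R j i) →
         (∀ i → Dec (A i)) → (S? : ∀ i → Dec (S i)) →
         (R? : ∀ i j → Dec (R i j)) →
         (∀ i → S i → ¬ A i → (# λ j → S? j ×-dec R? i j) < n) →
         (c : Fin m → Fin n) → Proper R A c → ∃ λ (c′ : Fin m → Fin n) → Proper R S c′
greedy {m} {n} {R} {A} {S} irrefl symm A? S? R? few c proper =
  let c′ , proper′ = go (allFin m)
  in c′ , λ i j Si Sj → proper′ i j (Si , inj₂ (∈-allFin i)) (Sj , inj₂ (∈-allFin j))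
  where
  Done : List (Fin m) → Fin m → Set
  Done xs j = S j × (A j ⊎ j List.∈ xs)

  drop-head : ∀ {x xs} → (S x → A x) → ∀ j → Done (x ∷ xs) j → Done xs j
  drop-head skip j (Sj , inj₁ Aj)           = Sj , inj₁ Aj
  drop-head skip j (Sj , inj₂ (here refl))  = Sj , inj₁ (skip Sj)
  drop-head skip j (Sj , inj₂ (there j∈xs)) = Sj , inj₂ j∈xs

  drop-other : ∀ {x xs} j → j ≢ x → Done (x ∷ xs) j → Done xs j
  drop-other j j≢x (Sj , inj₁ Aj)           = Sj , inj₁ Aj
  drop-other j j≢x (Sj , inj₂ (here j≡x))   = contradiction j≡x j≢x
  drop-other j j≢x (Sj , inj₂ (there j∈xs)) = Sj , inj₂ j∈xs

  go : ∀ xs → ∃ λ (c′ : Fin m → Fin n) → Proper R (Done xs) c′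
  go []       = c , λ where
    i j (_ , inj₁ Ai) (_ , inj₁ Aj) → proper i j Ai Aj
  go (x ∷ xs) with go xs | S? x | A? x
  ... | c′ , proper′ | no ¬Sx | _ =
    c′ , λ i j Di Dj → let d = drop-head (λ Sx → contradiction Sx ¬Sx) in proper′ i j (d i Di) (d j Dj)
  ... | c′ , proper′ | yes _  | yes Ax =
    c′ , λ i j Di Dj → let d = drop-head (λ _ → Ax) in proper′ i j (d i Di) (d j Dj)
  ... | c′ , proper′ | yes Sx | no ¬Ax with free-value (λ j → S? j ×-dec R? x j) c′ (few x Sx ¬Ax)
  ...   | a , free = c″ , proper″
    where
    c″ : Fin m → Fin n
    c″ = updateAt c′ x (const a)

    new : c″ x ≡ a
    new = updateAt-updates x c′

    old : ∀ {j} → j ≢ x → c″ j ≡ c′ j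
    old {j} j≢x = updateAt-minimal j x c′ j≢x

    proper″ : Proper R (Done (x ∷ xs)) c″
    proper″ i j Di Dj Rij eq with i ≟ x | j ≟ x
    ... | yes refl | yes refl = irrefl i Rij
    ... | yes refl | no j≢x   = free j (proj₁ Dj , Rij) (trans (sym (old j≢x)) (trans (sym eq) new))
    ... | no i≢x   | yes refl = free i (proj₁ Di , symm i j Rij) (trans (sym (old i≢x)) (trans eq new))
    ... | no i≢x   | no j≢x   = proper′ i j (drop-other i i≢x Di) (drop-other j j≢x Dj) Rij
                                  (trans (sym (old i≢x)) (trans eq (old j≢x)))

-- Greedy colouring for the relation `_≢_`: a member of `T` conflicts with all the others, fewer
-- than `n`. A starting map is asked for because `Fin n` may be empty.
injective-on : ∀ {m n} {T : Fin m → Set} (T? : ∀ i → Dec (T i)) → # T? ≤ n → (Fin m → Fin n) →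
               ∃ λ (c : Fin m → Fin n) → ∀ i j → T i → T j → c i ≡ c j → i ≡ j
injective-on {m} {n} T? #T≤n c₀ =
  let c , proper = greedy {A = λ _ → ⊥} (λ _ i≢i → i≢i refl) (λ _ _ i≢j → i≢j ∘ sym) (λ _ → no λ ()) T? ≢?
                     (λ i Ti _ → ≤-trans (≤-reflexive (sym (#-remove T? i Ti))) #T≤n)
                     c₀ (λ _ _ ())
  in c , λ i j Ti Tj eq → decidable-stable (i ≟ j) λ i≢j → proper i j Ti Tj i≢j eq
  where
  ≢? : ∀ (i j : Fin m) → Dec (i ≢ j)
  ≢? i j = ¬? (i ≟ j)

-- Linear systems of sets

module LinearSystem {m n s : ℕ} (E : Fin m → Subset n)
  (linear : ∀ i j v w → v ∈ E i → w ∈ E i → v ∈ E j → w ∈ E j → i ≢ j → v ≡ w)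
  (2≤size : ∀ i → 2 ≤ # λ v → v ∈? E i)
  (deg≤ : ∀ v → (# λ i → v ∈? E i) ≤ suc s)
  (s²≤n : s * s ≤ n)
  where

  size : Fin m → ℕ
  size i = # λ v → v ∈? E i

  Meets : Fin m → Fin m → Set
  Meets i j = i ≢ j × ∃ λ v → v ∈ E i × v ∈ E j

  Meets? : ∀ i j → Dec (Meets i j)
  Meets? i j = ¬? (i ≟ j) ×-dec any? λ v → (v ∈? E i) ×-dec (v ∈? E j)

  Meets-irrefl : ∀ i → ¬ Meets i i
  Meets-irrefl i (i≢i , _) = i≢i refl

  Meets-sym : ∀ i j → Meets i j → Meets j i
  Meets-sym i j (i≢j , v , v∈i , v∈j) = i≢j ∘ sym , v , v∈j , v∈i

  Long : ℕ → Fin m → Set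
  Long k j = k ≤ size j

  Long? : ∀ k j → Dec (Long k j)
  Long? k j = k ≤? size j

  conflicts : ℕ → Fin m → ℕ
  conflicts k i = # λ j → Long? k j ×-dec Meets? i j

  size≤n : ∀ i → size i ≤ n
  size≤n i = ≤-trans (m≤n+m _ _) (≤-reflexive (#-¬ λ v → v ∈? E i))

  -- Counting the long hyperedges that meet a fixed one.

  module Through {t : ℕ} (i : Fin m) (size-i : size i ≡ suc t) where

    Line : Fin n → Fin m → Set
    Line v j = Long (suc t) j × i ≢ j × v ∈ E j

    Line? : ∀ v j → Dec (Line v j)
    Line? v j = Long? (suc t) j ×-dec (¬? (i ≟ j) ×-dec (v ∈? E j))

    Other? : ∀ v j w → Dec (w ∈ E j × v ≢ w)
    Other? v j w = (w ∈? E j) ×-dec ¬? (v ≟ w)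

    lines : Fin n → ℕ
    lines v = # (Line? v)

    joins : Fin n → Fin n → ℕ
    joins v w = # λ j → Line? v j ×-dec Other? v j w

    off : ℕ
    off = # λ w → ¬? (w ∈? E i)

    off+size : off + suc t ≡ n
    off+size = trans (cong (off +_) (sym size-i)) (#-¬ λ w → w ∈? E i)

    others : ∀ v j → v ∈ E j → size j ≡ suc (# (Other? v j))
    others v j v∈j = #-remove (λ w → w ∈? E j) v v∈j

    -- Linearity is used twice: two vertices lie on at most one common hyperedge, and a line through
    -- `v` has no second vertex in `E i`.
    joins≤ : ∀ v w → v ∈ E i → joins v w ≤ ⟦ ¬? (w ∈? E i) ⟧
    joins≤ v w v∈i = #≤⟦⟧ (λ j → Line? v j ×-dec Other? v j w) (¬? (w ∈? E i))
      (λ { j ((_ , i≢j , v∈j) , w∈j , v≢w) w∈i → v≢w (linear i j v w v∈i w∈i v∈j w∈j i≢j) })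
      (λ { j j′ ((_ , _ , v∈j) , w∈j , v≢w) ((_ , _ , v∈j′) , w∈j′ , _) →
           decidable-stable (j ≟ j′) λ j≢j′ → v≢w (linear j j′ v w v∈j w∈j v∈j′ w∈j′ j≢j′) })

    line-term : ∀ v j → ⟦ Line? v j ⟧ * t ≤ ⟦ Line? v j ⟧ * # (Other? v j)
    line-term v j = ⟦⟧*-mono (Line? v j) λ { (long , _ , v∈j) →
      s≤s⁻¹ (≤-trans long (≤-reflexive (others v j v∈j))) }

    others≤off : ∀ v → v ∈ E i → (sum λ j → ⟦ Line? v j ⟧ * # (Other? v j)) ≤ off
    others≤off v v∈i = ≤-trans (≤-reflexive (double-count (Line? v) (Other? v)))
                               (sum-mono λ w → joins≤ v w v∈i)

    -- Apart from `v`, the lines through `v` are pairwise disjoint, lie off `E i` and have at least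
    -- `t` vertices each.
    lines*t≤off : ∀ v → v ∈ E i → lines v * t ≤ off
    lines*t≤off v v∈i = ≤-trans (≤-reflexive (sym (sum-⟦⟧*const (Line? v) t)))
      (≤-trans (sum-mono (line-term v)) (others≤off v v∈i))

    -- `E i` itself uses up one of the at most `suc s` hyperedges through `v`.
    lines≤s : ∀ v → v ∈ E i → lines v ≤ s
    lines≤s v v∈i = s≤s⁻¹ (≤-trans
      (s≤s (#-mono (Line? v) (λ j → (v ∈? E j) ×-dec ¬? (i ≟ j)) λ { _ (_ , i≢j , v∈j) → v∈j , i≢j }))
      (≤-trans (≤-reflexive (sym (#-remove (λ j → v ∈? E j) i v∈i))) (deg≤ v)))

    conflicts≤Σlines : conflicts (suc t) i ≤ sum λ v → ⟦ v ∈? E i ⟧ * lines v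
    conflicts≤Σlines = ≤-trans
      (sum-mono λ j → ⟦⟧≤# (λ v → (v ∈? E i) ×-dec Line? v j) (Long? (suc t) j ×-dec Meets? i j)
        λ { (long , i≢j , v , v∈i , v∈j) → v , v∈i , long , i≢j , v∈j })
      (≤-reflexive (sym (double-count (λ v → v ∈? E i) Line?)))

    Σ≤ : ∀ (f : Fin n → ℕ) k → (∀ v → v ∈ E i → f v ≤ k) → (sum λ v → ⟦ v ∈? E i ⟧ * f v) ≤ suc t * k
    Σ≤ f k f≤k = ≤-trans (sum-mono λ v → ⟦⟧*-mono (v ∈? E i) (f≤k v))
      (≤-reflexive (trans (sum-⟦⟧*const (λ v → v ∈? E i) k) (cong (_* k) size-i)))

    -- This sums `lines*t≤off` over the `suc t` vertices of `E i`. With `k = suc t` it is the bound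
    -- k (n - k) / (k - 1), cleared of its denominator.
    conflicts*t≤ : conflicts (suc t) i * t ≤ suc t * off
    conflicts*t≤ = begin
      conflicts (suc t) i * t                      ≤⟨ *-monoˡ-≤ t conflicts≤Σlines ⟩
      (sum λ v → ⟦ v ∈? E i ⟧ * lines v) * t       ≡⟨ *-distribʳ-sum t (λ v → ⟦ v ∈? E i ⟧ * lines v) ⟩
      (sum λ v → ⟦ v ∈? E i ⟧ * lines v * t)       ≡⟨ sum-cong-≗ (λ v → *-assoc ⟦ v ∈? E i ⟧ (lines v) t) ⟩
      (sum λ v → ⟦ v ∈? E i ⟧ * (lines v * t))     ≤⟨ Σ≤ (λ v → lines v * t) off lines*t≤off ⟩
      suc t * off                                  ∎
      where open ≤-Reasoning

    1≤t : 1 ≤ t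
    1≤t = s≤s⁻¹ (≤-trans (2≤size i) (≤-reflexive size-i))

    conflicts≥n⇒square : n ≤ conflicts (suc t) i → suc t * suc t ≡ n
    conflicts≥n⇒square n≤N with <-cmp (suc t * suc t) n
    ... | tri≈ _ eq _ = eq
    -- Adding the square to both sides turns `off` into `n` and avoids truncated subtraction; what
    -- remains after cancelling `n * t` is `suc t * suc t ≤ n`.
    ... | tri> _ _ K²>n = contradiction K²>n (≤⇒≯ (+-cancelˡ-≤ (n * t) _ _ (begin
      n * t + suc t * suc t             ≤⟨ +-monoˡ-≤ _ (≤-trans (*-monoˡ-≤ t n≤N) conflicts*t≤) ⟩
      suc t * off + suc t * suc t       ≡⟨ sym (*-distribˡ-+ (suc t) off (suc t)) ⟩
      suc t * (off + suc t)             ≡⟨ cong (suc t *_) off+size ⟩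
      n + t * n                         ≡⟨ trans (+-comm n _) (cong (_+ n) (*-comm t n)) ⟩
      n * t + n                         ∎)))
      where open ≤-Reasoning
    -- Both branches use the bound `suc t * s` given by the degrees; the split decides whether it is
    -- compared with the square of `suc t` or with that of `s`.
    ... | tri< K²<n _ _ with s ≤? suc t
    ...   | yes s≤K = contradiction n≤N (<⇒≱ (begin-strict
      conflicts (suc t) i   ≤⟨ conflicts≤Σlines ⟩
      _                     ≤⟨ Σ≤ lines s lines≤s ⟩
      suc t * s             ≤⟨ *-monoʳ-≤ (suc t) s≤K ⟩
      suc t * suc t         <⟨ K²<n ⟩
      n                     ∎))
      where open ≤-Reasoning
    ...   | no s≰K = contradiction n≤N (<⇒≱ (begin-strict
      conflicts (suc t) i   ≤⟨ conflicts≤Σlines ⟩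
      _                     ≤⟨ Σ≤ lines s lines≤s ⟩
      suc t * s             <⟨ ≤-trans (+-monoˡ-≤ _ (≤-trans (s≤s z≤n) (≰⇒> s≰K))) (*-monoˡ-≤ s (≰⇒> s≰K)) ⟩
      s * s                 ≤⟨ s²≤n ⟩
      n                     ∎))
      where open ≤-Reasoning

    -- The equality case: part of an affine plane.

    module Tight (square : suc t * suc t ≡ n) (n≤N : n ≤ conflicts (suc t) i) where

      off≡ : off ≡ suc t * t
      off≡ = +-cancelʳ-≡ (suc t) _ _
        (trans off+size (trans (sym square) (trans (*-suc (suc t) t) (+-comm (suc t) _))))

      lines≤K : ∀ v → v ∈ E i → lines v ≤ suc t
      lines≤K v v∈i = *-cancelʳ-≤ _ _ t {{>-nonZero 1≤t}}
        (≤-trans (lines*t≤off v v∈i) (≤-reflexive off≡))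

      conflicts≤n : conflicts (suc t) i ≤ n
      conflicts≤n = ≤-trans conflicts≤Σlines (≤-trans (Σ≤ lines (suc t) lines≤K) (≤-reflexive square))

      -- The `suc t` vertices of `E i` carry at most `suc t` lines each and together at least `n`,
      -- which is the product; so no vertex falls short.
      lines≡K : ∀ v → v ∈ E i → lines v ≡ suc t
      lines≡K v v∈i = ⟦⟧*-cancel (v ∈? E i)
        (sum-mono-rigid (λ v → ⟦⟧*-mono (v ∈? E i) (lines≤K v))
          (≤-trans (≤-reflexive (trans (sum-⟦⟧*const (λ v → v ∈? E i) (suc t)) (trans (cong (_* suc t) size-i) square)))
            (≤-trans n≤N conflicts≤Σlines)) v)
        v∈i

      off≤lines*t : ∀ v → v ∈ E i → off ≤ sum λ j → ⟦ Line? v j ⟧ * t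
      off≤lines*t v v∈i = ≤-reflexive (trans off≡
        (trans (cong (_* t) (sym (lines≡K v v∈i))) (sym (sum-⟦⟧*const (Line? v) t))))

      -- The `suc t` lines through `v` have at least `t` further vertices each and share only
      -- `suc t * t` vertices off `E i`.
      size-line : ∀ v j → v ∈ E i → Line v j → size j ≡ suc t
      size-line v j v∈i l@(_ , _ , v∈j) = trans (others v j v∈j) (cong suc (sym
        (⟦⟧*-cancel (Line? v j) (sum-mono-rigid (line-term v) (≤-trans (others≤off v v∈i) (off≤lines*t v v∈i)) j) l)))

      -- The same count leaves no vertex off `E i` uncovered: exactly one line joins it to each `v`
      -- in `E i`, as in an affine plane.
      joins≡ : ∀ v w → v ∈ E i → joins v w ≡ ⟦ ¬? (w ∈? E i) ⟧
      joins≡ v w v∈i = sum-mono-rigid (λ w → joins≤ v w v∈i)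
        (≤-trans (off≤lines*t v v∈i) (≤-trans (sum-mono (line-term v)) (≤-reflexive (double-count (Line? v) (Other? v))))) w

      -- Suppose that `f` and `g` meet in `w`. Distinct lines join `w` to the `suc t` vertices of
      -- `E i`; together with `f` and `g` they give `w` degree at least `suc t + 2`, hence
      -- `suc t < s`. But `s²≤n` forces `s ≤ suc t`.
      parallel : ∀ f g → ¬ Meets i f → ¬ Meets i g → ¬ Meets f g
      parallel f g i∦f i∦g (f≢g , w , w∈f , w∈g) = contradiction K<s (≤⇒≯ s≤K)
        where
        open ≤-Reasoning

        -- No hyperedge meets itself in the sense of `Meets`, so `f = i` must be ruled out: `w`
        -- would then witness that `i` meets `g`.
        i≢f : i ≢ f
        i≢f i≡f = i∦g ((λ i≡g → f≢g (trans (sym i≡f) i≡g)) , w , subst (λ j → w ∈ E j) (sym i≡f) w∈f , w∈g)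

        w∉i : ¬ w ∈ E i
        w∉i w∈i = i∦f (i≢f , w , w∈i , w∈f)

        s≤K : s ≤ suc t
        s≤K with s ≤? suc t
        ... | yes s≤K = s≤K
        ... | no  s≰K = contradiction (≤-trans s²≤n (≤-reflexive (sym square)))
                          (<⇒≱ (*-mono-< (≰⇒> s≰K) (≰⇒> s≰K)))

        Rest? : ∀ j → Dec ((w ∈ E j × f ≢ j) × g ≢ j)
        Rest? j = ((w ∈? E j) ×-dec ¬? (f ≟ j)) ×-dec ¬? (g ≟ j)

        Joins? : ∀ v j → Dec (Line v j × w ∈ E j × v ≢ w)
        Joins? v j = Line? v j ×-dec Other? v j w

        -- Each `v` in `E i` yields one line through `w`. Conversely, a line contains at most one
        -- such `v`, and none of the lines is `f` or `g`, which miss `E i`.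
        K≤rest : suc t ≤ # Rest?
        K≤rest = begin
          suc t                                           ≡⟨ sym (trans (*-identityʳ _) size-i) ⟩
          size i * 1                                      ≡⟨ sym (sum-⟦⟧*const (λ v → v ∈? E i) 1) ⟩
          (sum λ v → ⟦ v ∈? E i ⟧ * 1)                    ≤⟨ sum-mono (λ v → ⟦⟧*-mono (v ∈? E i) λ v∈i →
                                                               ≤-reflexive (sym (trans (joins≡ v w v∈i) (⟦⟧-true (¬? (w ∈? E i)) w∉i)))) ⟩
          (sum λ v → ⟦ v ∈? E i ⟧ * joins v w)            ≡⟨ double-count (λ v → v ∈? E i) Joins? ⟩
          (sum λ j → # λ v → (v ∈? E i) ×-dec Joins? v j) ≤⟨ sum-mono (λ j → #≤⟦⟧ (λ v → (v ∈? E i) ×-dec Joins? v j) (Rest? j)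
            (λ { v (v∈i , (_ , i≢j , v∈j) , w∈j , _) →
                 (w∈j , λ { refl → i∦f (i≢j , v , v∈i , v∈j) }) , λ { refl → i∦g (i≢j , v , v∈i , v∈j) } })
            (λ { v v′ (v∈i , (_ , i≢j , v∈j) , _) (v′∈i , (_ , _ , v′∈j) , _) →
                 linear i j v v′ v∈i v′∈i v∈j v′∈j i≢j })) ⟩
          # Rest?                                         ∎

        K<s : suc t < s
        K<s = s≤s⁻¹ (begin
          suc (suc (suc t))    ≤⟨ s≤s (s≤s K≤rest) ⟩
          suc (suc (# Rest?))  ≡⟨ cong suc (sym (#-remove (λ j → (w ∈? E j) ×-dec ¬? (f ≟ j)) g (w∈g , f≢g))) ⟩
          _                    ≡⟨ sym (#-remove (λ j → w ∈? E j) f w∈f) ⟩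
          _                    ≤⟨ deg≤ w ⟩
          suc s                ∎)

      Neighbour : Fin m → Set
      Neighbour j = Long (suc t) j × Meets i j

      Neighbour? : ∀ j → Dec (Neighbour j)
      Neighbour? j = Long? (suc t) j ×-dec Meets? i j

      -- A line f through v ∈ E i has only t points off E i, so it cannot
      -- meet all the t + 1 lines through another vertex v′ ∈ E i.
      disjoint-neighbours : ∃ λ f → ∃ λ g → Neighbour f × Neighbour g × f ≢ g × ¬ Meets f g
      disjoint-neighbours
        with #-∃ (λ v → v ∈? E i) (≤-trans (s≤s z≤n) (2≤size i))
      ... | v , v∈i
        with #-∃ (Other? v i) (≤-trans 1≤t (≤-reflexive (cong (_∸ 1) (trans (sym size-i) (others v i v∈i)))))
           | #-∃ (Line? v) (≤-trans (s≤s z≤n) (≤-reflexive (sym (lines≡K v v∈i))))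
      ... | v′ , v′∈i , v≢v′ | f , l@(long-f , i≢f , v∈f)
        with any? (λ g → Line? v′ g ×-dec ¬? (any? λ w → (w ∈? E f) ×-dec (w ∈? E g)))
      ... | yes (g , (long-g , i≢g , v′∈g) , apart) =
        f , g , (long-f , i≢f , v , v∈i , v∈f) , (long-g , i≢g , v′ , v′∈i , v′∈g) ,
        (λ { refl → apart (v , v∈f , v∈f) }) , λ { (_ , w , w∈f , w∈g) → apart (w , w∈f , w∈g) }
      ... | no none = contradiction K≤t (<⇒≱ ≤-refl)
        where
        open ≤-Reasoning

        v′∉f : ¬ v′ ∈ E f
        v′∉f v′∈f = v≢v′ (linear i f v v′ v∈i v′∈i v∈f v′∈f i≢f)

        hit : ∀ g → Line v′ g → ∃ λ w → w ∈ E f × Line v′ g × w ∈ E g × v′ ≢ w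
        hit g l′ =
          let w , w∈f , w∈g = decidable-stable (any? λ w → (w ∈? E f) ×-dec (w ∈? E g)) λ ¬h → none (g , l′ , ¬h)
          in w , w∈f , l′ , w∈g , λ v′≡w → v′∉f (subst (_∈ E f) (sym v′≡w) w∈f)

        Hit? : ∀ w g → Dec (Line v′ g × w ∈ E g × v′ ≢ w)
        Hit? w g = Line? v′ g ×-dec Other? v′ g w

        -- By `joins≤`, no vertex of `E f` is hit by two lines through `v′`, and the hit vertices
        -- lie off `E i`, hence among the `t` vertices of `E f` other than `v`.
        K≤t : suc t ≤ t
        K≤t = begin
          suc t                                             ≡⟨ sym (lines≡K v′ v′∈i) ⟩
          lines v′                                          ≤⟨ sum-mono (λ g → ⟦⟧≤# (λ w → (w ∈? E f) ×-dec Hit? w g) (Line? v′ g) (hit g)) ⟩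
          (sum λ g → # λ w → (w ∈? E f) ×-dec Hit? w g)     ≡⟨ sym (double-count (λ w → w ∈? E f) Hit?) ⟩
          (sum λ w → ⟦ w ∈? E f ⟧ * joins v′ w)             ≤⟨ sum-mono (λ w → *-monoʳ-≤ ⟦ w ∈? E f ⟧ (joins≤ v′ w v′∈i)) ⟩
          (sum λ w → ⟦ w ∈? E f ⟧ * ⟦ ¬? (w ∈? E i) ⟧)      ≡⟨ sum-cong-≗ (λ w → sym (⟦⟧-× (w ∈? E f) (¬? (w ∈? E i)))) ⟩
          (# λ w → (w ∈? E f) ×-dec ¬? (w ∈? E i))          ≤⟨ #-mono (λ w → (w ∈? E f) ×-dec ¬? (w ∈? E i)) (Other? v f)
                                                                 (λ { w (w∈f , w∉i) → w∈f , λ { refl → w∉i v∈i } }) ⟩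
          # (Other? v f)                                    ≡⟨ cong (_∸ 1) (trans (sym (others v f v∈f)) (size-line v f v∈i l)) ⟩
          t                                                 ∎

      -- Identifying the parallel class of i with i and f with g leaves at
      -- most n sets, which receive distinct colours.
      colour : (Fin m → Fin n) → ∃ λ (c : Fin m → Fin n) → Proper Meets (Long (suc t)) c
      colour c₀ with disjoint-neighbours
      ... | f , g , nf@(_ , i≢f , _) , ng@(_ , i≢g , _) , f≢g , f∦g =
        let c , inj = injective-on T? #T≤n c₀
        in (λ j → c (q j)) , λ j k lj lk meet eq →
             q-proper j k lj lk meet (inj (q j) (q k) (q∈T j lj) (q∈T k lk) eq)
        where
        T : Fin m → Set
        T j = i ≡ j ⊎ (Neighbour j × f ≢ j)

        T? : ∀ j → Dec (T j)
        T? j = (i ≟ j) ⊎-dec (Neighbour? j ×-dec ¬? (f ≟ j))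

        -- `i` enters `T` in exchange for `f`, so `T` is no larger than the set of conflicts of `i`.
        #T≤n : # T? ≤ n
        #T≤n = begin
          # T?                                              ≡⟨ #-remove T? i (inj₁ refl) ⟩
          suc (# λ j → T? j ×-dec ¬? (i ≟ j))               ≤⟨ s≤s (#-mono (λ j → T? j ×-dec ¬? (i ≟ j)) (λ j → Neighbour? j ×-dec ¬? (f ≟ j))
                                                                 λ { j (inj₁ i≡j , i≢j) → contradiction i≡j i≢j ; j (inj₂ nj , _) → nj }) ⟩
          suc (# λ j → Neighbour? j ×-dec ¬? (f ≟ j))       ≡⟨ sym (#-remove Neighbour? f nf) ⟩
          conflicts (suc t) i                               ≤⟨ conflicts≤n ⟩
          n                                                 ∎
          where open ≤-Reasoning

        q : Fin m → Fin m
        q j with Meets? i j | f ≟ j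
        ... | no _  | _     = i
        ... | yes _ | yes _ = g
        ... | yes _ | no _  = j

        q∈T : ∀ j → Long (suc t) j → T (q j)
        q∈T j long with Meets? i j | f ≟ j
        ... | no _  | _      = inj₁ refl
        ... | yes _ | yes _  = inj₂ (ng , f≢g)
        ... | yes m | no f≢j = inj₂ ((long , m) , f≢j)

        q-proper : ∀ j k → Long (suc t) j → Long (suc t) k → Meets j k → q j ≢ q k
        -- Representatives agree only within the class of `i`, within the pair `f`, `g`, or when
        -- `j = k`, and in none of these do the two sets meet. In the mixed cases `i` would equal a
        -- set that it meets.
        q-proper j k lj lk meet eq with Meets? i j | f ≟ j | Meets? i k | f ≟ k
        ... | no i∦j | _        | no i∦k        | _        = parallel j k i∦j i∦k meet
        ... | no _   | _        | yes _         | yes _    = i≢g eq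
        ... | no _   | _        | yes (i≢k , _) | no _     = i≢k eq
        ... | yes _  | yes _    | no _          | _        = i≢g (sym eq)
        ... | yes (i≢j , _) | no _ | no _       | _        = i≢j (sym eq)
        ... | yes _  | yes refl | yes _         | yes refl = Meets-irrefl f meet
        ... | yes _  | yes refl | yes _         | no _     = f∦g (subst (Meets f) (sym eq) meet)
        ... | yes _  | no _     | yes _         | yes refl = f∦g (Meets-sym g f (subst (λ x → Meets x f) eq meet))
        ... | yes _  | no _     | yes _         | no _     = Meets-irrefl k (subst (λ x → Meets x k) eq meet)

  -- Descent on the size of the hyperedges.

  module _ (c₀ : Fin m → Fin n) where

    -- Normally the hyperedges of size exactly `k` are added greedily. If one of them has at least
    -- `n` conflicts, the earlier colouring is discarded and the equality case colours everything of
    -- size at least `k` afresh.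
    extend : ∀ k → (∃ λ (c : Fin m → Fin n) → Proper Meets (Long (suc k)) c) →
             ∃ λ (c : Fin m → Fin n) → Proper Meets (Long k) c
    extend k (c , proper) with any? (λ i → (size i ≟ⁿ k) ×-dec (n ≤? conflicts k i))
    ... | no none = greedy Meets-irrefl Meets-sym (Long? (suc k)) (Long? k) Meets?
      (λ i long ¬longer → ≰⇒> λ n≤N → none (i , ≤-antisym (s≤s⁻¹ (≰⇒> ¬longer)) long , n≤N))
      c proper
    extend zero    _ | yes (i , size≡0 , _) = contradiction (subst (2 ≤_) size≡0 (2≤size i)) λ ()
    extend (suc t) _ | yes (i , size-i , n≤N) = Tight.colour (conflicts≥n⇒square n≤N) n≤N c₀
      where open Through i size-i

    -- `d` counts the remaining steps. At `d = 0` the threshold `k` exceeds `n`, so no hyperedge is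
    -- long enough and any map will do.
    descend : ∀ d k → n < d + k → ∃ λ (c : Fin m → Fin n) → Proper Meets (Long k) c
    descend zero    k n<k = c₀ , λ i _ long _ _ → contradiction (≤-trans n<k long) (≤⇒≯ (size≤n i))
    descend (suc d) k n<  = extend k (descend d (suc k) (≤-trans n< (≤-reflexive (sym (+-suc d k)))))

    colouring : ∃ λ (c : Fin m → Fin n) → ∀ i j → Meets i j → c i ≢ c j
    colouring = let c , proper = descend (suc n) 0 (s≤s (m≤m+n n 0))
                in c , λ i j → proper i j z≤n z≤n

-- From hypergraphs to linear systems of sets.

∣∣≡# : ∀ {n} (p : Subset n) → ∣ p ∣ ≡ # λ v → v ∈? p
∣∣≡# []            = refl
∣∣≡# (inside ∷ p)  = cong suc (∣∣≡# p)
∣∣≡# (outside ∷ p) = ∣∣≡# p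

length-filter≡# : ∀ {A : Set} {P : A → Set} (P? : ∀ x → Dec (P x)) xs →
                  length (filter P? xs) ≡ # λ i → P? (lookup xs i)
length-filter≡# P? []       = refl
length-filter≡# P? (x ∷ xs) with does (P? x)
... | true  = cong suc (length-filter≡# P? xs)
... | false = length-filter≡# P? xs

lookup-injective : ∀ {A : Set} {xs : List A} → Unique xs → ∀ i j → lookup xs i ≡ lookup xs j → i ≡ j
lookup-injective (_ ∷ _)    zero    zero    eq = refl
lookup-injective (x∉ ∷ _)   zero    (suc j) eq = contradiction eq (All.lookup x∉ (∈-lookup j))
lookup-injective (x∉ ∷ _)   (suc i) zero    eq = contradiction (sym eq) (All.lookup x∉ (∈-lookup i))
lookup-injective (_ ∷ uniq) (suc i) (suc j) eq = cong suc (lookup-injective uniq i j eq)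

-- Removing two distinct members one after the other lowers the cardinality strictly twice.
∣∣≤1⇒subsingleton : ∀ {n} {p : Subset n} {v w} → ∣ p ∣ ≤ 1 → v ∈ p → w ∈ p → v ≡ w
∣∣≤1⇒subsingleton {v = v} {w} ∣p∣≤1 v∈p w∈p = decidable-stable (v ≟ w) λ v≢w →
  contradiction (≤-trans (s≤s (≤-trans (s≤s z≤n) (x∈p⇒∣p-x∣<∣p∣ (x∈p∧x≢y⇒x∈p-y w∈p (v≢w ∘ sym)))))
                         (≤-trans (x∈p⇒∣p-x∣<∣p∣ v∈p) ∣p∣≤1)) λ { (s≤s ()) }

theorem5p1 : ∀ (n : ℕ) (H : Hypergraph n) → Linear H → Loopless H → Δ H ≤√ n +1 → chromaticIndex H ≤ n
theorem5p1 n H linear loopless Δ≤ =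
  -- A chosen vertex of each hyperedge gives the starting map into `Fin n`, not necessarily proper.
  -- This covers `n = 0` too, where no hyperedge exists.
  let c , proper = colouring λ i → proj₁ (nonempty-edge i)
  in proj₂ (chromaticIndex-isLeast H) n
       (c , λ { i j e≢f (v , v∈) → proper i j ((λ { refl → e≢f refl }) , v , x∈p∩q⁻ (E i) (E j) v∈) })
  where
  E : Fin (length (edges H)) → Subset n
  E = lookup (edges H)

  nonempty-edge : ∀ i → ∃ λ v → v ∈ E i
  nonempty-edge i = All.lookup (nonempty H) (∈-lookup i)

  2≤# : ∀ i → 2 ≤ # λ v → v ∈? E i
  2≤# i = subst (2 ≤_) (∣∣≡# (E i)) (≤∧≢⇒<
    (let v , v∈ = nonempty-edge i in ≤-trans (s≤s z≤n) (x∈p⇒∣p-x∣<∣p∣ v∈))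
    (loopless (∈-lookup i) ∘ sym))

  -- Here `s` is `Δ H ∸ 1`. Truncation is harmless: for `Δ H = 0` the bound becomes 1, weaker but
  -- still true.
  deg≤ : ∀ v → (# λ i → v ∈? E i) ≤ suc (Δ H ∸ 1)
  deg≤ v = ≤-trans (≤-reflexive (sym (length-filter≡# (v ∈?_) (edges H))))
    (≤-trans (All.lookup (xs≤max 0 (map (degree H) (allFin n))) (∈-map⁺ (degree H) (∈-allFin v)))
             (m≤n+m∸n (Δ H) 1))

  open LinearSystem E
    (λ i j v w v∈i w∈i v∈j w∈j i≢j → ∣∣≤1⇒subsingleton
      (linear (∈-lookup i) (∈-lookup j) (i≢j ∘ lookup-injective (unique H) i j))
      (x∈p∩q⁺ (v∈i , v∈j)) (x∈p∩q⁺ (w∈i , w∈j)))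
    2≤# deg≤ (subst (_≤ n) (cong ((Δ H ∸ 1) *_) (*-identityʳ (Δ H ∸ 1))) Δ≤)
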